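{- The process of building a computon control flow graph (CFG) is functorial, i.e., the assignment $\mathscr{C}\colon\mathbf{Set}^{\mathbf{Comp}}\to\mathbf{Set}^{\mathbf{Gr}}$ is a functor.
   Context: $\mathbf{Set}$ is the category of finite sets and total functions. A computon $\lambda$ is a tuple $(U,P,I,O,\Sigma,\sigma,\tau,t,s,c)$ (a functor into $\mathbf{Set}$ from the free category on the arrows $\sigma:O\to U$, $\tau:I\to U$, $t:O\to P$, $s:I\to P$, $c:P\to\Sigma$) where $U$ (computation units), $I$ and $O$ (edges) are possibly empty finite sets, $P$ (ports) is a non-empty finite set, $\Sigma\subset\mathbb{N}$ (colours) is finite with $0\in\Sigma$, the functions $\sigma,\tau,c$ are surjective, and: the restrictions $\sigma|_{(c\circ t)^{ -1}(0)}$ and $\tau|_{(c\circ s)^{ -1}(0)}$ are surjective onto $U$; there is $p\in P\setminus \mathrm{Im}(s)$ with $c(p)=0$; there is $q\in P\setminus \mathrm{Im}(t)$ with $c(q)=0$. Components of $\lambda_j$ carry the subscript $j$. Put $P^+=P\setminus \mathrm{Im}(t)$ and $P^-=P\setminus \mathrm{Im}(s)$. For a port $p$, $\bullet p=\{u\in U\mid \exists o\in O,\ \sigma(o)=u,\ t(o)=p\}$ and $p\bullet=\{u\in U\mid\exists i\in I,\ s(i)=p,\ \tau(i)=u\}$. A computon morphism $\alpha:\lambda_1\to\lambda_2$ is a natural transformation (functions $\alpha_U,\alpha_P,\alpha_I,\alpha_O,\alpha_\Sigma$ commuting with $\sigma,\tau,t,s,c$) such that $\alpha_\Sigma$ is the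 inclusion $\Sigma_1\subseteq\Sigma_2$ and $\vec{i}(\alpha)\cup\vec{o}(\alpha)\subseteq P_1^+\cup P_1^-$, where $\vec{i}(\alpha)=\{p\in P_1\mid \bullet\alpha(p)\setminus\alpha(\bullet p)\ne\emptyset\}$ and $\vec{o}(\alpha)=\{p\in P_1\mid \alpha(p)\bullet\setminus\alpha(p\bullet)\neq\emptyset\}$. Computons and computon morphisms form the category $\mathbf{Set}^{\mathbf{Comp}}$ (componentwise composition). $\mathbf{Set}^{\mathbf{Gr}}$ is the category of directed labelled graphs: objects consist of sets $E,V,L$ with functions $\vec{s},\vec{t}:E\to V$ and $l:V\to L$; morphisms are triples of functions on $E,V,L$ commuting with $\vec s,\vec t,l$. The sets $U$ and $P$ (respectively $I$ and $O$) of a computon are regarded as disjoint, and $\kappa$ is a fixed label with $\kappa\notin\mathbb{N}$. The CFG $\mathscr{C}(\lambda)$ has $V=U\cup\{p\in P\mid c(p)=0\}$; $E=\{i\in I\mid c(s(i))=0\}\cup\{o\in O\mid c(t(o))=0\}$; $L=\{0,\kappa\}$; $\vec{s}(e)=s(e)$ if $e\in I$ and $\sigma(e)$ if $e\in O$; $\vec{t}(e)=t(e)$ if $e\in O$ and $\tau(e)$ if $e\in I$; $l(v)=c(v)$ if $v\in P$ and $\kappa$ if $v\in U$. For a computon morphism $\alpha:\lambda_1\to\lambda_2$, $\mathscr{C}(\alpha)$ has components $\mathscr{C}(\alpha)_V(v)=\alpha_U(v)$ if $v\in U_1$ and $\alpha_P(v)$ if $v\in P_1$; $\mathscr{C}(\alpha)_E(e)=\alpha_I(e)$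 if $e\in I_1$ and $\alpha_O(e)$ if $e\in O_1$; $\mathscr{C}(\alpha)_L(x)=\alpha_\Sigma(x)$ if $x\in\Sigma_1$ and $\kappa$ otherwise. -}

module Defs where

open import Level using (Level; _⊔_; 0ℓ) renaming (suc to lsuc)
open import Data.Fin.Base using (Fin; zero; suc)
import Data.Fin.Properties as Fin
open import Data.Irrelevant as Irrelevant using ([_])
open import Data.Nat.Base using (ℕ; zero; suc)
import Data.Nat.Properties as ℕ
open import Data.Product.Base using (∃; ∃-syntax; _×_; _,_; proj₂)
open import Data.Refinement.Base as Refinement using (Refinement-syntax; value; _,_)
open import Data.Refinement.Properties using (value-injective)
open import Data.Sum.Base as Sum using (_⊎_; inj₁; inj₂; [_,_]′)
open import Data.Sum.Function.Propositional using (_⊎-↔_)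
open import Function.Base using (_∘′_; id)
open import Function.Bundles using (_↔_; mk↔ₛ′; Inverse)
open import Function.Definitions using (StrictlySurjective)
open import Function.Properties.Inverse using (↔-sym; ↔-trans; ↔⇒↣)
open import Relation.Binary.Core using (Rel)
open import Relation.Binary.Definitions using (DecidableEquality)
open import Relation.Binary.PropositionalEquality using (_≡_; refl; sym; trans; cong; subst)
open import Relation.Binary.Structures using (IsEquivalence)
open import Relation.Nullary.Decidable using (Dec; yes; no; map′; via-injection; _×-dec_)
open import Relation.Nullary.Negation.Core using (contradiction-irr)
open import Relation.Unary using (Pred; Decidable; _∈_; _⊆_; _∪_; _∖_; ∁; Satisfiable)

-- Morphisms carry their own equality, since function extensionality is
-- not available.
record Category (o ℓ e : Level) : Set (lsuc (o ⊔ ℓ ⊔ e)) where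
  infix  4 _≈_
  infixr 9 _∘_
  field
    Obj           : Set o
    Hom           : Obj → Obj → Set ℓ
    _≈_           : ∀ {A B} → Rel (Hom A B) e
    identity      : ∀ {A} → Hom A A
    _∘_           : ∀ {A B C} → Hom B C → Hom A B → Hom A C
    isEquivalence : ∀ {A B} → IsEquivalence (_≈_ {A} {B})
    ∘-resp-≈      : ∀ {A B C} {g g′ : Hom B C} {f f′ : Hom A B} →
                    g ≈ g′ → f ≈ f′ → g ∘ f ≈ g′ ∘ f′
    identityˡ     : ∀ {A B} {f : Hom A B} → identity ∘ f ≈ f
    identityʳ     : ∀ {A B} {f : Hom A B} → f ∘ identity ≈ f
    assoc         : ∀ {A B C D} {f : Hom A B} {g : Hom B C} {h : Hom C D} →
                    (h ∘ g) ∘ f ≈ h ∘ (g ∘ f)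

record IsFunctor {o ℓ e o′ ℓ′ e′ : Level}
                 (𝓐 : Category o ℓ e) (𝓑 : Category o′ ℓ′ e′)
                 (F₀ : Category.Obj 𝓐 → Category.Obj 𝓑)
                 (F₁ : ∀ {A B} → Category.Hom 𝓐 A B → Category.Hom 𝓑 (F₀ A) (F₀ B))
                 : Set (o ⊔ ℓ ⊔ e ⊔ e′) where
  private
    module A = Category 𝓐
    module B = Category 𝓑
  field
    F-resp-≈     : ∀ {X Y} {f g : A.Hom X Y} → f A.≈ g → F₁ f B.≈ F₁ g
    F-identity   : ∀ {X} → F₁ (A.identity {X}) B.≈ B.identity
    homomorphism : ∀ {X Y Z} {f : A.Hom X Y} {g : A.Hom Y Z} →
                   F₁ (g A.∘ f) B.≈ F₁ g B.∘ F₁ f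

Finite : Set → Set
Finite A = ∃[ n ] (A ↔ Fin n)

module _ {A : Set} (fin : Finite A) where

  private module A↔Fin = Inverse (proj₂ fin)

  finite-≟ : DecidableEquality A
  finite-≟ = via-injection (↔⇒↣ (proj₂ fin)) Fin._≟_

  finite-any? : {P : Pred A 0ℓ} → Decidable P → Dec (∃ P)
  finite-any? {P} P? = map′
    (λ (i , p) → A↔Fin.from i , p)
    (λ (a , p) → A↔Fin.to a , subst P (sym (A↔Fin.strictlyInverseʳ a)) p)
    (Fin.any? λ i → P? (A↔Fin.from i))

⊎-finite : {A B : Set} → Finite A → Finite B → Finite (A ⊎ B)
⊎-finite (_ , f) (_ , g) = _ , ↔-trans (f ⊎-↔ g) (↔-sym Fin.+↔⊎)

Fin-refine : ∀ {n} {P : Pred (Fin n) 0ℓ} → Decidable P → Finite [ i ∈ Fin n ∣ P i ]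
Fin-refine {zero} P? = 0 , mk↔ₛ′ value (λ ()) (λ ()) λ { (() , _) }
Fin-refine {suc n} {P} P? with Fin-refine {n} (λ i → P? (suc i)) | P? zero
... | m , f | yes p = suc m , mk↔ₛ′ to from to∘from from∘to
  where
  module f = Inverse f
  suc′ : [ i ∈ Fin n ∣ P (suc i) ] → [ i ∈ Fin (suc n) ∣ P i ]
  suc′ (i , q) = suc i , q
  to : [ i ∈ Fin (suc n) ∣ P i ] → Fin (suc m)
  to (zero  , _) = zero
  to (suc i , q) = suc (f.to (i , q))
  from : Fin (suc m) → [ i ∈ Fin (suc n) ∣ P i ]
  from zero    = zero , [ p ]
  from (suc j) = suc′ (f.from j)
  to∘from : ∀ j → to (from j) ≡ j
  to∘from zero    = refl
  to∘from (suc j) = cong suc (f.strictlyInverseˡ j)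
  from∘to : ∀ x → from (to x) ≡ x
  from∘to (zero  , _) = refl
  from∘to (suc i , q) = cong suc′ (f.strictlyInverseʳ (i , q))
... | m , f | no ¬p = m , ↔-trans (mk↔ₛ′ to from (λ _ → refl) from∘to) f
  where
  to : [ i ∈ Fin (suc n) ∣ P i ] → [ i ∈ Fin n ∣ P (suc i) ]
  to (zero  , [ q ]) = contradiction-irr q ¬p
  to (suc i , q)     = i , q
  from : [ i ∈ Fin n ∣ P (suc i) ] → [ i ∈ Fin (suc n) ∣ P i ]
  from (i , q) = suc i , q
  from∘to : ∀ x → from (to x) ≡ x
  from∘to (zero  , [ q ]) = contradiction-irr q ¬p
  from∘to (suc i , q)     = refl

refine-finite : {A : Set} {P : Pred A 0ℓ} →
                Finite A → Decidable P → Finite [ a ∈ A ∣ P a ]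
refine-finite {A} {P} (n , f) P? with Fin-refine {n} (λ i → P? (Inverse.from f i))
... | m , g = m , ↔-trans (mk↔ₛ′ to from to∘from from∘to) g
  where
  module f = Inverse f
  to : [ a ∈ A ∣ P a ] → [ i ∈ Fin n ∣ P (f.from i) ]
  to (a , [ p ]) = f.to a , [ subst P (sym (f.strictlyInverseʳ a)) p ]
  from : [ i ∈ Fin n ∣ P (f.from i) ] → [ a ∈ A ∣ P a ]
  from (i , p) = f.from i , p
  to∘from : ∀ x → to (from x) ≡ x
  to∘from (i , _) = value-injective (f.strictlyInverseˡ i)
  from∘to : ∀ x → from (to x) ≡ x
  from∘to (a , _) = value-injective (f.strictlyInverseʳ a)

Im : {A B : Set} → (A → B) → Pred B 0ℓ
Im f b = ∃[ a ] f a ≡ b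

image : {A B : Set} → (A → B) → Pred A 0ℓ → Pred B 0ℓ
image f S b = ∃[ a ] a ∈ S × f a ≡ b

∖-image-∘ : {A B C : Set} {f : A → B} {g : B → C}
            {R : Pred A 0ℓ} {S : Pred B 0ℓ} {T : Pred C 0ℓ} →
            Decidable (image g S) →
            Satisfiable (T ∖ image (g ∘′ f) R) →
            Satisfiable (S ∖ image f R) ⊎ Satisfiable (T ∖ image g S)
∖-image-∘ {g = g} gS? (c , c∈T , c∉gfR) with gS? c
... | no  c∉gS               = inj₂ (c , c∈T , c∉gS)
... | yes (b , b∈S , gb≡c) = inj₁ (b , b∈S , λ (a , a∈R , fa≡b) →
                               c∉gfR (a , a∈R , trans (cong g fa≡b) gb≡c))

record Computon : Set₁ where
  field
    U P I O  : Set
    Colours  : Pred ℕ 0ℓ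

  -- The set Σ; membership proofs are irrelevant, so Colour is a genuine
  -- subset of ℕ even though Colours may be proof-relevant.
  Colour : Set
  Colour = [ n ∈ ℕ ∣ n ∈ Colours ]

  field
    σ : O → U
    τ : I → U
    t : O → P
    s : I → P
    c : P → Colour

  colour : P → ℕ
  colour p = value (c p)

  P⁺ : Pred P 0ℓ
  P⁺ = ∁ (Im t)

  P⁻ : Pred P 0ℓ
  P⁻ = ∁ (Im s)

  field
    U-finite      : Finite U
    P-finite      : Finite P
    I-finite      : Finite I
    O-finite      : Finite O
    Colour-finite : Finite Colour
    P-nonempty    : P
    0∈Colours     : 0 ∈ Colours
    σ-surjective  : StrictlySurjective _≡_ σ
    τ-surjective  : StrictlySurjective _≡_ τ
    c-surjective  : StrictlySurjective _≡_ c
    σ|₀-surjective : StrictlySurjective _≡_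
      (λ (o : [ o ∈ O ∣ colour (t o) ≡ 0 ]) → σ (value o))
    τ|₀-surjective : StrictlySurjective _≡_
      (λ (i : [ i ∈ I ∣ colour (s i) ≡ 0 ]) → τ (value i))
    P⁻₀-nonempty  : ∃[ p ] p ∈ P⁻ × colour p ≡ 0
    P⁺₀-nonempty  : ∃[ q ] q ∈ P⁺ × colour q ≡ 0

  infix 8 •_ _•

  •_ : P → Pred U 0ℓ
  (• p) u = ∃[ o ] σ o ≡ u × t o ≡ p

  _• : P → Pred U 0ℓ
  (p •) u = ∃[ i ] s i ≡ p × τ i ≡ u

module _ (Λ₁ Λ₂ : Computon) where
  private
    module Λ₁ = Computon Λ₁
    module Λ₂ = Computon Λ₂

  module _ (αU : Λ₁.U → Λ₂.U) (αP : Λ₁.P → Λ₂.P) where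

    i⃗ o⃗ : Pred Λ₁.P 0ℓ
    i⃗ p = Satisfiable (Λ₂.• (αP p) ∖ image αU (Λ₁.• p))
    o⃗ p = Satisfiable ((αP p) Λ₂.• ∖ image αU (p Λ₁.•))

  record ComputonMorphism : Set where
    field
      αU : Λ₁.U → Λ₂.U
      αP : Λ₁.P → Λ₂.P
      αI : Λ₁.I → Λ₂.I
      αO : Λ₁.O → Λ₂.O
      αΣ : Λ₁.Colour → Λ₂.Colour
      σ-commute   : ∀ o → αU (Λ₁.σ o) ≡ Λ₂.σ (αO o)
      τ-commute   : ∀ i → αU (Λ₁.τ i) ≡ Λ₂.τ (αI i)
      t-commute   : ∀ o → αP (Λ₁.t o) ≡ Λ₂.t (αO o)
      s-commute   : ∀ i → αP (Λ₁.s i) ≡ Λ₂.s (αI i)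
      c-commute   : ∀ p → αΣ (Λ₁.c p) ≡ Λ₂.c (αP p)
      αΣ-inclusion : ∀ x → value (αΣ x) ≡ value x
      boundary    : i⃗ αU αP ∪ o⃗ αU αP ⊆ Λ₁.P⁺ ∪ Λ₁.P⁻

module _ {Λ₁ Λ₂ : Computon} where

  infix 4 _≈ᶜ_

  record _≈ᶜ_ (α β : ComputonMorphism Λ₁ Λ₂) : Set where
    private
      module α = ComputonMorphism α
      module β = ComputonMorphism β
    field
      ≈U : ∀ u → α.αU u ≡ β.αU u
      ≈P : ∀ p → α.αP p ≡ β.αP p
      ≈I : ∀ i → α.αI i ≡ β.αI i
      ≈O : ∀ o → α.αO o ≡ β.αO o
      ≈Σ : ∀ x → α.αΣ x ≡ β.αΣ x

idᶜ : {Λ : Computon} → ComputonMorphism Λ Λ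
idᶜ = record
  { αU = id ; αP = id ; αI = id ; αO = id ; αΣ = id
  ; σ-commute    = λ _ → refl
  ; τ-commute    = λ _ → refl
  ; t-commute    = λ _ → refl
  ; s-commute    = λ _ → refl
  ; c-commute    = λ _ → refl
  ; αΣ-inclusion = λ _ → refl
  ; boundary     = λ
    { (inj₁ (u , u∈ , u∉)) → contradiction-irr (u , u∈ , refl) u∉
    ; (inj₂ (u , u∈ , u∉)) → contradiction-irr (u , u∈ , refl) u∉
    }
  }

infixr 9 _∘ᶜ_

_∘ᶜ_ : {Λ₁ Λ₂ Λ₃ : Computon} →
       ComputonMorphism Λ₂ Λ₃ → ComputonMorphism Λ₁ Λ₂ → ComputonMorphism Λ₁ Λ₃
_∘ᶜ_ {Λ₁} {Λ₂} {Λ₃} β α = record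
  { αU = β.αU ∘′ α.αU
  ; αP = β.αP ∘′ α.αP
  ; αI = β.αI ∘′ α.αI
  ; αO = β.αO ∘′ α.αO
  ; αΣ = β.αΣ ∘′ α.αΣ
  ; σ-commute    = λ o → trans (cong β.αU (α.σ-commute o)) (β.σ-commute _)
  ; τ-commute    = λ i → trans (cong β.αU (α.τ-commute i)) (β.τ-commute _)
  ; t-commute    = λ o → trans (cong β.αP (α.t-commute o)) (β.t-commute _)
  ; s-commute    = λ i → trans (cong β.αP (α.s-commute i)) (β.s-commute _)
  ; c-commute    = λ p → trans (cong β.αΣ (α.c-commute p)) (β.c-commute _)
  ; αΣ-inclusion = λ x → trans (β.αΣ-inclusion _) (α.αΣ-inclusion x)
  ; boundary     =
    [ [ α.boundary ∘′ inj₁ , reflect ∘′ β.boundary ∘′ inj₁ ]′ ∘′ ∖-image-∘ (pre? _)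
    , [ α.boundary ∘′ inj₂ , reflect ∘′ β.boundary ∘′ inj₂ ]′ ∘′ ∖-image-∘ (post? _)
    ]′
  }
  where
  module Λ₁ = Computon Λ₁
  module Λ₂ = Computon Λ₂
  module Λ₃ = Computon Λ₃
  module α = ComputonMorphism α
  module β = ComputonMorphism β

  pre? : ∀ p → Decidable (image β.αU (Λ₂.• p))
  pre? p u = map′
    (λ (o , to≡p , e) → Λ₂.σ o , (o , refl , to≡p) , e)
    (λ { (_ , (o , refl , to≡p) , e) → o , to≡p , e })
    (finite-any? Λ₂.O-finite λ o →
      finite-≟ Λ₂.P-finite (Λ₂.t o) p ×-dec finite-≟ Λ₃.U-finite (β.αU (Λ₂.σ o)) u)

  post? : ∀ p → Decidable (image β.αU (p Λ₂.•))
  post? p u = map′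
    (λ (i , si≡p , e) → Λ₂.τ i , (i , si≡p , refl) , e)
    (λ { (_ , (i , si≡p , refl) , e) → i , si≡p , e })
    (finite-any? Λ₂.I-finite λ i →
      finite-≟ Λ₂.P-finite (Λ₂.s i) p ×-dec finite-≟ Λ₃.U-finite (β.αU (Λ₂.τ i)) u)

  reflect : ∀ {p} → α.αP p ∈ Λ₂.P⁺ ∪ Λ₂.P⁻ → p ∈ Λ₁.P⁺ ∪ Λ₁.P⁻
  reflect = Sum.map
    (λ αp∉ (o , to≡p) → αp∉ (α.αO o , trans (sym (α.t-commute o)) (cong α.αP to≡p)))
    (λ αp∉ (i , si≡p) → αp∉ (α.αI i , trans (sym (α.s-commute i)) (cong α.αP si≡p)))

≈ᶜ-isEquivalence : {Λ₁ Λ₂ : Computon} → IsEquivalence (_≈ᶜ_ {Λ₁} {Λ₂})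
≈ᶜ-isEquivalence {Λ₁} {Λ₂} = record { refl = ≈ᶜ-refl ; sym = ≈ᶜ-sym ; trans = ≈ᶜ-trans }
  where
  ≈ᶜ-refl : {α : ComputonMorphism Λ₁ Λ₂} → α ≈ᶜ α
  ≈ᶜ-refl = record
    { ≈U = λ _ → refl ; ≈P = λ _ → refl ; ≈I = λ _ → refl
    ; ≈O = λ _ → refl ; ≈Σ = λ _ → refl }
  ≈ᶜ-sym : {α β : ComputonMorphism Λ₁ Λ₂} → α ≈ᶜ β → β ≈ᶜ α
  ≈ᶜ-sym e = record
    { ≈U = λ x → sym (≈U x) ; ≈P = λ x → sym (≈P x) ; ≈I = λ x → sym (≈I x)
    ; ≈O = λ x → sym (≈O x) ; ≈Σ = λ x → sym (≈Σ x) }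
    where
    open _≈ᶜ_ e
  ≈ᶜ-trans : {α β γ : ComputonMorphism Λ₁ Λ₂} → α ≈ᶜ β → β ≈ᶜ γ → α ≈ᶜ γ
  ≈ᶜ-trans d e = record
    { ≈U = λ x → trans (d.≈U x) (e.≈U x)
    ; ≈P = λ x → trans (d.≈P x) (e.≈P x)
    ; ≈I = λ x → trans (d.≈I x) (e.≈I x)
    ; ≈O = λ x → trans (d.≈O x) (e.≈O x)
    ; ≈Σ = λ x → trans (d.≈Σ x) (e.≈Σ x) }
    where
    module d = _≈ᶜ_ d
    module e = _≈ᶜ_ e

∘ᶜ-resp-≈ᶜ : {Λ₁ Λ₂ Λ₃ : Computon}
             {β β′ : ComputonMorphism Λ₂ Λ₃} {α α′ : ComputonMorphism Λ₁ Λ₂} →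
             β ≈ᶜ β′ → α ≈ᶜ α′ → β ∘ᶜ α ≈ᶜ β′ ∘ᶜ α′
∘ᶜ-resp-≈ᶜ {β = β} d e = record
  { ≈U = λ x → trans (cong αU (e.≈U x)) (d.≈U _)
  ; ≈P = λ x → trans (cong αP (e.≈P x)) (d.≈P _)
  ; ≈I = λ x → trans (cong αI (e.≈I x)) (d.≈I _)
  ; ≈O = λ x → trans (cong αO (e.≈O x)) (d.≈O _)
  ; ≈Σ = λ x → trans (cong αΣ (e.≈Σ x)) (d.≈Σ _) }
  where
  open ComputonMorphism β
  module d = _≈ᶜ_ d
  module e = _≈ᶜ_ e

Set-Comp : Category (lsuc 0ℓ) 0ℓ 0ℓ
Set-Comp = record
  { Obj           = Computon
  ; Hom           = ComputonMorphism
  ; _≈_           = _≈ᶜ_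
  ; identity      = idᶜ
  ; _∘_           = _∘ᶜ_
  ; isEquivalence = ≈ᶜ-isEquivalence
  ; ∘-resp-≈      = ∘ᶜ-resp-≈ᶜ
  ; identityˡ     = record
      { ≈U = λ _ → refl ; ≈P = λ _ → refl ; ≈I = λ _ → refl
      ; ≈O = λ _ → refl ; ≈Σ = λ _ → refl }
  ; identityʳ     = record
      { ≈U = λ _ → refl ; ≈P = λ _ → refl ; ≈I = λ _ → refl
      ; ≈O = λ _ → refl ; ≈Σ = λ _ → refl }
  ; assoc         = record
      { ≈U = λ _ → refl ; ≈P = λ _ → refl ; ≈I = λ _ → refl
      ; ≈O = λ _ → refl ; ≈Σ = λ _ → refl }
  }

record Graph : Set₁ where
  field
    E V L    : Set
    E-finite : Finite E
    V-finite : Finite V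
    L-finite : Finite L
    s⃗ t⃗      : E → V
    l        : V → L

module _ (G H : Graph) where
  private
    module G = Graph G
    module H = Graph H

  record IsGraphMorphism (fE : G.E → H.E) (fV : G.V → H.V) (fL : G.L → H.L) : Set where
    field
      s⃗-commute : ∀ e → fV (G.s⃗ e) ≡ H.s⃗ (fE e)
      t⃗-commute : ∀ e → fV (G.t⃗ e) ≡ H.t⃗ (fE e)
      l-commute : ∀ v → fL (G.l v) ≡ H.l (fV v)

  record GraphMorphism : Set where
    field
      fE : G.E → H.E
      fV : G.V → H.V
      fL : G.L → H.L
      isGraphMorphism : IsGraphMorphism fE fV fL
    open IsGraphMorphism isGraphMorphism public

module _ {G H : Graph} where

  infix 4 _≈ᵍ_

  record _≈ᵍ_ (f g : GraphMorphism G H) : Set where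
    private
      module f = GraphMorphism f
      module g = GraphMorphism g
    field
      ≈E : ∀ e → f.fE e ≡ g.fE e
      ≈V : ∀ v → f.fV v ≡ g.fV v
      ≈L : ∀ x → f.fL x ≡ g.fL x

idᵍ : {G : Graph} → GraphMorphism G G
idᵍ = record
  { fE = id ; fV = id ; fL = id
  ; isGraphMorphism = record
    { s⃗-commute = λ _ → refl ; t⃗-commute = λ _ → refl ; l-commute = λ _ → refl }
  }

infixr 9 _∘ᵍ_

_∘ᵍ_ : {G H K : Graph} → GraphMorphism H K → GraphMorphism G H → GraphMorphism G K
g ∘ᵍ f = record
  { fE = g.fE ∘′ f.fE
  ; fV = g.fV ∘′ f.fV
  ; fL = g.fL ∘′ f.fL
  ; isGraphMorphism = record
    { s⃗-commute = λ e → trans (cong g.fV (f.s⃗-commute e)) (g.s⃗-commute _)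
    ; t⃗-commute = λ e → trans (cong g.fV (f.t⃗-commute e)) (g.t⃗-commute _)
    ; l-commute = λ v → trans (cong g.fL (f.l-commute v)) (g.l-commute _)
    }
  }
  where
  module g = GraphMorphism g
  module f = GraphMorphism f

≈ᵍ-isEquivalence : {G H : Graph} → IsEquivalence (_≈ᵍ_ {G} {H})
≈ᵍ-isEquivalence {G} {H} = record { refl = ≈ᵍ-refl ; sym = ≈ᵍ-sym ; trans = ≈ᵍ-trans }
  where
  ≈ᵍ-refl : {f : GraphMorphism G H} → f ≈ᵍ f
  ≈ᵍ-refl = record { ≈E = λ _ → refl ; ≈V = λ _ → refl ; ≈L = λ _ → refl }
  ≈ᵍ-sym : {f g : GraphMorphism G H} → f ≈ᵍ g → g ≈ᵍ f
  ≈ᵍ-sym e = record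
    { ≈E = λ x → sym (≈E x) ; ≈V = λ x → sym (≈V x) ; ≈L = λ x → sym (≈L x) }
    where
    open _≈ᵍ_ e
  ≈ᵍ-trans : {f g h : GraphMorphism G H} → f ≈ᵍ g → g ≈ᵍ h → f ≈ᵍ h
  ≈ᵍ-trans d e = record
    { ≈E = λ x → trans (d.≈E x) (e.≈E x)
    ; ≈V = λ x → trans (d.≈V x) (e.≈V x)
    ; ≈L = λ x → trans (d.≈L x) (e.≈L x) }
    where
    module d = _≈ᵍ_ d
    module e = _≈ᵍ_ e

∘ᵍ-resp-≈ᵍ : {G H K : Graph} {g g′ : GraphMorphism H K} {f f′ : GraphMorphism G H} →
             g ≈ᵍ g′ → f ≈ᵍ f′ → g ∘ᵍ f ≈ᵍ g′ ∘ᵍ f′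
∘ᵍ-resp-≈ᵍ {g = g} d e = record
  { ≈E = λ x → trans (cong fE (e.≈E x)) (d.≈E _)
  ; ≈V = λ x → trans (cong fV (e.≈V x)) (d.≈V _)
  ; ≈L = λ x → trans (cong fL (e.≈L x)) (d.≈L _) }
  where
  open GraphMorphism g
  module d = _≈ᵍ_ d
  module e = _≈ᵍ_ e

Set-Gr : Category (lsuc 0ℓ) 0ℓ 0ℓ
Set-Gr = record
  { Obj           = Graph
  ; Hom           = GraphMorphism
  ; _≈_           = _≈ᵍ_
  ; identity      = idᵍ
  ; _∘_           = _∘ᵍ_
  ; isEquivalence = ≈ᵍ-isEquivalence
  ; ∘-resp-≈      = ∘ᵍ-resp-≈ᵍ
  ; identityˡ     = record { ≈E = λ _ → refl ; ≈V = λ _ → refl ; ≈L = λ _ → refl }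
  ; identityʳ     = record { ≈E = λ _ → refl ; ≈V = λ _ → refl ; ≈L = λ _ → refl }
  ; assoc         = record { ≈E = λ _ → refl ; ≈V = λ _ → refl ; ≈L = λ _ → refl }
  }

data Label : Set where
  nat : ℕ → Label
  κ   : Label

-- The set {0, κ} inside ℕ ∪ {κ}.
CFGLabel : Set
CFGLabel = [ x ∈ Label ∣ x ≡ nat 0 ⊎ x ≡ κ ]

nat≡⇒≡0 : ∀ {n} → nat n ≡ nat 0 ⊎ nat n ≡ κ → n ≡ 0
nat≡⇒≡0 (inj₁ refl) = refl

CFGLabel-finite : Finite CFGLabel
CFGLabel-finite = 2 , mk↔ₛ′ to from to∘from from∘to
  where
  to : CFGLabel → Fin 2
  to (nat _ , _) = zero
  to (κ     , _) = suc zero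
  from : Fin 2 → CFGLabel
  from zero       = nat 0 , [ inj₁ refl ]
  from (suc zero) = κ , [ inj₂ refl ]
  to∘from : ∀ i → to (from i) ≡ i
  to∘from zero       = refl
  to∘from (suc zero) = refl
  from∘to : ∀ x → from (to x) ≡ x
  from∘to (nat zero    , _)     = refl
  from∘to (nat (suc n) , [ q ]) = contradiction-irr (nat≡⇒≡0 q) λ ()
  from∘to (κ           , _)     = refl

module _ (Λ : Computon) where
  open Computon Λ

  -- Disjointness of U and P, and of I and O, is rendered by _⊎_.

  CFG-V : Set
  CFG-V = U ⊎ [ p ∈ P ∣ colour p ≡ 0 ]

  CFG-E : Set
  CFG-E = [ i ∈ I ∣ colour (s i) ≡ 0 ] ⊎ [ o ∈ O ∣ colour (t o) ≡ 0 ]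

  CFG-s⃗ : CFG-E → CFG-V
  CFG-s⃗ (inj₁ (i , z)) = inj₂ (s i , z)
  CFG-s⃗ (inj₂ (o , _)) = inj₁ (σ o)

  CFG-t⃗ : CFG-E → CFG-V
  CFG-t⃗ (inj₁ (i , _)) = inj₁ (τ i)
  CFG-t⃗ (inj₂ (o , z)) = inj₂ (t o , z)

  CFG-l : CFG-V → CFGLabel
  CFG-l (inj₁ u)       = κ , [ inj₂ refl ]
  CFG-l (inj₂ (p , z)) = nat (colour p) , Irrelevant.map (λ e → inj₁ (cong nat e)) z

  𝒞₀ : Graph
  𝒞₀ = record
    { E        = CFG-E
    ; V        = CFG-V
    ; L        = CFGLabel
    ; E-finite = ⊎-finite (refine-finite I-finite λ i → colour (s i) ℕ.≟ 0)
                          (refine-finite O-finite λ o → colour (t o) ℕ.≟ 0)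
    ; V-finite = ⊎-finite U-finite (refine-finite P-finite λ p → colour p ℕ.≟ 0)
    ; L-finite = CFGLabel-finite
    ; s⃗        = CFG-s⃗
    ; t⃗        = CFG-t⃗
    ; l        = CFG-l
    }

module _ {Λ₁ Λ₂ : Computon} (α : ComputonMorphism Λ₁ Λ₂) where
  open ComputonMorphism α
  private
    module Λ₁ = Computon Λ₁
    module Λ₂ = Computon Λ₂

  colour-preserved : ∀ p → Λ₂.colour (αP p) ≡ Λ₁.colour p
  colour-preserved p =
    trans (cong value (sym (c-commute p))) (αΣ-inclusion (Λ₁.c p))

  𝒞V : CFG-V Λ₁ → CFG-V Λ₂
  𝒞V = Sum.map αU (Refinement.map αP λ {p} z → trans (colour-preserved p) z)

  𝒞E : CFG-E Λ₁ → CFG-E Λ₂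
  𝒞E = Sum.map
    (Refinement.map αI λ {i} z →
      trans (cong Λ₂.colour (sym (s-commute i))) (trans (colour-preserved _) z))
    (Refinement.map αO λ {o} z →
      trans (cong Λ₂.colour (sym (t-commute o))) (trans (colour-preserved _) z))

  -- A label nat n in {0, κ} has n ≡ 0, hence always lies in Σ₁.
  𝒞L : CFGLabel → CFGLabel
  𝒞L (nat n , [ q ]) =
    nat (value (αΣ x)) , [ inj₁ (cong nat (trans (αΣ-inclusion x) (nat≡⇒≡0 q))) ]
    where
    x : Λ₁.Colour
    x = n , [ subst Λ₁.Colours (sym (nat≡⇒≡0 q)) Λ₁.0∈Colours ]
  𝒞L (κ , q) = κ , q

  -- Compatibility with s⃗, t⃗ and l is left as an argument.
  𝒞₁ : IsGraphMorphism (𝒞₀ Λ₁) (𝒞₀ Λ₂) 𝒞E 𝒞V 𝒞L → GraphMorphism (𝒞₀ Λ₁) (𝒞₀ Λ₂)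
  𝒞₁ isGraphMorphism = record
    { fE = 𝒞E ; fV = 𝒞V ; fL = 𝒞L ; isGraphMorphism = isGraphMorphism }

{-# OPTIONS --safe #-}
module Submission where

open import Defs
open import Data.Product.Base using (Σ-syntax; _,_)
open import Data.Refinement.Base using (value; _,_)
open import Data.Refinement.Properties using (value-injective)
open import Data.Sum.Base using (inj₁; inj₂)
open import Relation.Binary.PropositionalEquality using (refl; sym; trans; cong)

-- A morphism is an inclusion on colours, so it keeps colour 0 and restricts to control ports and
-- control edges. Its naturality squares for `σ`, `τ`, `t`, `s` then become those for source and
-- target. The restrictions act componentwise, and membership proofs are irrelevant, so the functor
-- laws reduce to equalities of underlying values.

𝒞-isGraphMorphism : (Λ₁ Λ₂ : Computon) (α : ComputonMorphism Λ₁ Λ₂) →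
                    IsGraphMorphism (𝒞₀ Λ₁) (𝒞₀ Λ₂) (𝒞E α) (𝒞V α) (𝒞L α)
𝒞-isGraphMorphism Λ₁ Λ₂ α = record
  { s⃗-commute = λ
    { (inj₁ (i , _)) → cong inj₂ (value-injective (s-commute i))
    ; (inj₂ (o , _)) → cong inj₁ (σ-commute o)
    }
  ; t⃗-commute = λ
    { (inj₁ (i , _)) → cong inj₁ (τ-commute i)
    ; (inj₂ (o , _)) → cong inj₂ (value-injective (t-commute o))
    }
  ; l-commute = λ
    { (inj₁ _)       → refl
    -- Both labels carry the colour of `p` in `Λ₁`: one through `αΣ`, the other as the colour of the
    -- image port.
    ; (inj₂ (p , _)) →
        value-injective (cong nat (trans (αΣ-inclusion _) (sym (colour-preserved α p))))
    }
  }
  where open ComputonMorphism α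

𝒞-resp-≈ : {Λ₁ Λ₂ : Computon} {α β : ComputonMorphism Λ₁ Λ₂} → α ≈ᶜ β →
           𝒞₁ α (𝒞-isGraphMorphism Λ₁ Λ₂ α) ≈ᵍ 𝒞₁ β (𝒞-isGraphMorphism Λ₁ Λ₂ β)
𝒞-resp-≈ e = record
  { ≈E = λ
    { (inj₁ (i , _)) → cong inj₁ (value-injective (≈I i))
    ; (inj₂ (o , _)) → cong inj₂ (value-injective (≈O o))
    }
  ; ≈V = λ
    { (inj₁ u)       → cong inj₁ (≈U u)
    ; (inj₂ (p , _)) → cong inj₂ (value-injective (≈P p))
    }
  ; ≈L = λ
    -- The hole is the label read as a colour of the source computon.
    { (nat _ , _) → value-injective (cong (λ x → nat (value x)) (≈Σ _))
    ; (κ     , _) → refl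
    }
  }
  where open _≈ᶜ_ e

proposition12 : Σ[ wd ∈ ((Λ₁ Λ₂ : Computon) (α : ComputonMorphism Λ₁ Λ₂) →
    IsGraphMorphism (𝒞₀ Λ₁) (𝒞₀ Λ₂) (𝒞E α) (𝒞V α) (𝒞L α)) ]
    IsFunctor Set-Comp Set-Gr 𝒞₀ (λ {Λ₁} {Λ₂} α → 𝒞₁ α (wd Λ₁ Λ₂ α))
proposition12 = 𝒞-isGraphMorphism , record
  { F-resp-≈     = 𝒞-resp-≈
  ; F-identity   = record
    { ≈E = λ { (inj₁ _) → refl ; (inj₂ _) → refl }
    ; ≈V = λ { (inj₁ _) → refl ; (inj₂ _) → refl }
    ; ≈L = λ { (nat _ , _) → refl ; (κ , _) → refl }
    }
  ; homomorphism = record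
    { ≈E = λ { (inj₁ _) → refl ; (inj₂ _) → refl }
    ; ≈V = λ { (inj₁ _) → refl ; (inj₂ _) → refl }
    -- The colour that the second map rebuilds from its label is, by eta and proof irrelevance, the
    -- output of the first `αΣ`.
    ; ≈L = λ { (nat _ , _) → refl ; (κ , _) → refl }
    }
  }
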